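{- Let $s_l=(a_j)$, $1\le j\le l$, be an ordered string of non-negative integers, and let $n$ be at least the order of the Kyle graph associated with $s_l$. Assume that $O_n(s_l)$ is connected. Then $d(v_1)=d(v_n)=\delta(O_n(s_l))=\sum_{j=1}^{l}a_j$, and $v_1$ and $v_n$ are the only vertices of $O_n(s_l)$ with degree $\delta(O_n(s_l))$.
   Context: An ordered string $s_l=(a_j)$, $1\le j\le l$ ($l\ge 1$), is an $l$-tuple of non-negative integers; $j$ is the index of the entry $a_j$. For a positive integer $n$, the ornated graph $O_n(s_l)$ is the (in general non-simple) directed graph on vertices $v_1,\dots,v_n$ whose arcs, counted with multiplicity, are the following: each odd-indexed entry $a_t$ contributes one arc $(v_i,v_j)$ for every pair $i<j$ with $i+a_t\ge j$; each even-indexed entry $a_s$ contributes one arc $(v_i,v_j)$ for every pair $i>j$ with $i-a_s\le j$. It is connected if its underlying undirected graph is connected. The degree of a vertex is $d(v)=d^+(v)+d^-(v)$ (out-degree plus in-degree, with multiplicity); $\Delta(O_n(s_l))$ and $\delta(O_n(s_l))$ are the maximum and minimum degree. The maximum possible degree associated with $s_l$ is $\max_{n\ge 1}\Delta(O_n(s_l))$. The Kyle graph associated with $s_l$ is the ornated graph $O_n(s_l)$ of smallest order $n$ that has a vertex of this maximum possible degree. -}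

module Defs where

open import Data.Fin.Base using (Fin; zero; toℕ; fromℕ)
import Data.List.Base as List
import Data.List.Extrema.Nat as Extrema
open import Data.Nat.Base using (ℕ; suc; _+_; _∸_; _≤_; _<_; _>_; _≥_; NonZero)
open import Data.Nat.Divisibility using (_∣_; _∤_; _∣?_)
open import Data.Nat.Properties using (_≤?_; _<?_; _≥?_; _>?_)
open import Data.Product.Base using (_×_; ∃)
open import Data.Sum.Base using (_⊎_)
open import Data.Vec.Base using (Vec; lookup; tabulate; allFin; sum; count)
open import Relation.Binary.Construct.Closure.Equivalence using (EqClosure)
open import Relation.Binary.PropositionalEquality.Core using (_≡_)
open import Relation.Nullary.Decidable.Core using (Dec; ¬?; _×-dec_; _⊎-dec_)

-- A directed multigraph on n vertices: mult u v is the number of arcs (u , v).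
record MultiDigraph (n : ℕ) : Set where
  field
    mult : Fin n → Fin n → ℕ

module _ {n : ℕ} (G : MultiDigraph n) where
  open MultiDigraph G

  outDegree inDegree degree : Fin n → ℕ
  outDegree u = sum (tabulate (λ v → mult u v))
  inDegree  u = sum (tabulate (λ v → mult v u))
  degree    u = outDegree u + inDegree u

  Arc : Fin n → Fin n → Set
  Arc u v = mult u v ≥ 1

  -- EqClosure Arc u v is the type of walks from u to v ignoring orientation.
  Connected : Set
  Connected = ∀ u v → EqClosure Arc u v

v₁ : ∀ {n} .{{_ : NonZero n}} → Fin n
v₁ {suc _} = zero

vₙ : ∀ {n} .{{_ : NonZero n}} → Fin n
vₙ {suc m} = fromℕ m

-- The first argument of max and min is an initial value; taking the degree
-- of a vertex for it does not affect the result.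
Δ δ : ∀ {n} .{{_ : NonZero n}} → MultiDigraph n → ℕ
Δ {n} G = Extrema.max (degree G v₁) (List.map (degree G) (List.allFin n))
δ {n} G = Extrema.min (degree G v₁) (List.map (degree G) (List.allFin n))

-- Vertices and string entries are numbered from 1.
index : ∀ {n} → Fin n → ℕ
index i = suc (toℕ i)

module _ {l : ℕ} (s : Vec ℕ l) where

  -- Truncated subtraction agrees with i - a_t ≤ j in the integers, because
  -- j is non-negative.
  Contributes : ∀ {n} → Fin n → Fin n → Fin l → Set
  Contributes i j t =
      (2 ∤ index t × index i < index j × index i + lookup s t ≥ index j)
    ⊎ (2 ∣ index t × index i > index j × index i ∸ lookup s t ≤ index j)

  contributes? : ∀ {n} (i j : Fin n) (t : Fin l) → Dec (Contributes i j t)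
  contributes? i j t =
    (¬? (2 ∣? index t) ×-dec index i <? index j
      ×-dec index i + lookup s t ≥? index j)
    ⊎-dec
    (2 ∣? index t ×-dec index i >? index j
      ×-dec index i ∸ lookup s t ≤? index j)

ornated : ∀ n {l} → Vec ℕ l → MultiDigraph n
ornated n {l} s = record
  { mult = λ i j → count (contributes? s i j) (allFin l) }

module _ {l : ℕ} (s : Vec ℕ l) where

  -- D = max_{n ≥ 1} Δ(O_n(s)), with n = suc m.
  record IsMaxPossibleDegree (D : ℕ) : Set where
    field
      attained : ∃ λ m → Δ (ornated (suc m) s) ≡ D
      bound    : ∀ m → Δ (ornated (suc m) s) ≤ D

  record IsKyleOrder (k : ℕ) : Set where
    field
      maxDegree           : ℕ
      isMaxPossibleDegree : IsMaxPossibleDegree maxDegree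
      hasVertex           : ∃ λ v → degree (ornated k s) v ≡ maxDegree
      smallest            : ∀ n → (∃ λ v → degree (ornated n s) v ≡ maxDegree) → k ≤ n

{-# OPTIONS --safe #-}
module Submission where

-- Whatever its parity, an entry a contributes min(a , p) + min(a , q) to the
-- degree of a vertex with p vertices before it and q after it.  This is at most
-- 2 a, with equality only if 2 a ≤ p + q; a large enough graph attains the bound
-- for all entries at once, so the maximum possible degree is 2 Σ a, and once n
-- reaches the Kyle order 2 a ≤ n - 1 holds for every entry a.  Then
-- min(a , p) + min(a , q) ≥ a, with equality only if a, p or q is zero.

open import Defs
open import Data.Bool.Base using (true; false; if_then_else_)
open import Data.Fin.Base using (Fin; zero; suc; toℕ; fromℕ; _↑ˡ_)
open import Data.Fin.Properties using (toℕ-fromℕ; toℕ-↑ˡ; toℕ-injective; toℕ<n)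
import Data.List.Base as List
import Data.List.Extrema.Nat as Extrema
import Data.List.Membership.Propositional.Properties as ∈ₚ
import Data.List.Relation.Unary.All as All
import Data.List.Relation.Unary.All.Properties as Allₚ
open import Data.Nat.Base using (ℕ; zero; suc; _+_; _∸_; _⊓_; _≤_; _<_; z≤n; s≤s; z<s; s<s; s≤s⁻¹; s<s⁻¹; NonZero)
open import Data.Nat.Divisibility using (_∣?_)
open import Data.Nat.Properties
open import Data.Product.Base using (_×_; _,_)
open import Data.Sum.Base using (_⊎_; inj₁; inj₂; [_,_]′)
open import Data.Vec.Base using (Vec; sum; lookup; tabulate; count)
open import Data.Vec.Properties using (tabulate∘lookup)
open import Function.Base using (id; _∘_)
open import Function.Bundles using (_⇔_; mk⇔)
open import Relation.Binary.Construct.Closure.ReflexiveTransitive using (ε; _◅_)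
open import Relation.Binary.Construct.Closure.Symmetric using (fwd; bwd)
open import Relation.Binary.PropositionalEquality.Core using (_≡_; _≢_; refl; sym; trans; cong; cong₂; subst; subst₂)
open import Relation.Nullary.Decidable using (Dec; does; does-⇔; dec-false; yes; no; _×-dec_)
open import Relation.Nullary.Negation using (¬_; contradiction)
open import Relation.Unary using (Pred; Decidable)

open import Algebra.Properties.CommutativeMonoid.Sum +-0-commutativeMonoid as ∑
  using (sum-syntax; sum-cong-≗; ∑-distrib-+; ∑-comm)

-- Finite sums and indicators

sum-tabulate : ∀ {n} (f : Fin n → ℕ) → sum (tabulate f) ≡ ∑[ i < n ] f i
sum-tabulate {zero}  f = refl
sum-tabulate {suc n} f = cong (f zero +_) (sum-tabulate (f ∘ suc))

sum-lookup : ∀ {n} (s : Vec ℕ n) → sum s ≡ ∑[ i < n ] lookup s i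
sum-lookup s = trans (cong sum (sym (tabulate∘lookup s))) (sum-tabulate (lookup s))

∑-mono-≤ : ∀ {n} {f g : Fin n → ℕ} → (∀ i → f i ≤ g i) → ∑.sum f ≤ ∑.sum g
∑-mono-≤ {zero}  f≤g = z≤n
∑-mono-≤ {suc n} f≤g = +-mono-≤ (f≤g zero) (∑-mono-≤ (f≤g ∘ suc))

term≤∑ : ∀ {n} (f : Fin n → ℕ) i → f i ≤ ∑.sum f
term≤∑ f zero    = m≤m+n _ _
term≤∑ f (suc i) = m≤n⇒m≤o+n (f zero) (term≤∑ (f ∘ suc) i)

term≤sum : ∀ {n} (f : Fin n → ℕ) i → f i ≤ sum (tabulate f)
term≤sum f i = subst (f i ≤_) (sym (sum-tabulate f)) (term≤∑ f i)

-- A strict gap in one term cannot be made up by the others. This turns an equality of degrees into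
-- an equality for each string entry.
∑-mono-tight : ∀ {n} {f g : Fin n → ℕ} → (∀ i → f i ≤ g i) →
               ∑.sum g ≤ ∑.sum f → ∀ i → g i ≤ f i
∑-mono-tight {suc n} {f} {g} f≤g ∑g≤∑f zero =
  +-cancelʳ-≤ (∑.sum (g ∘ suc)) _ _
    (≤-trans ∑g≤∑f (+-monoʳ-≤ (f zero) (∑-mono-≤ (f≤g ∘ suc))))
∑-mono-tight {suc n} {f} {g} f≤g ∑g≤∑f (suc i) =
  ∑-mono-tight (f≤g ∘ suc)
    (+-cancelˡ-≤ (g zero) _ _ (≤-trans ∑g≤∑f (+-monoˡ-≤ _ (f≤g zero)))) i

-- The Iverson bracket: it turns `count` into a sum, so that sums over vertices and over entries can
-- be exchanged.
⟦_⟧ : ∀ {P : Set} → Dec P → ℕ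
⟦ P? ⟧ = if does P? then 1 else 0

⟦⟧-cong : ∀ {P Q : Set} (P? : Dec P) (Q? : Dec Q) → P ⇔ Q → ⟦ P? ⟧ ≡ ⟦ Q? ⟧
⟦⟧-cong P? Q? P⇔Q = cong (if_then 1 else 0) (does-⇔ P⇔Q P? Q?)

⟦⟧-false : ∀ {P : Set} (P? : Dec P) → ¬ P → ⟦ P? ⟧ ≡ 0
⟦⟧-false P? ¬P = cong (if_then 1 else 0) (dec-false P? ¬P)

count-tabulate : ∀ {A : Set} {P : Pred A _} (P? : Decidable P) {n} (f : Fin n → A) →
                 count P? (tabulate f) ≡ ∑[ i < n ] ⟦ P? (f i) ⟧
count-tabulate P? {zero}  f = refl
count-tabulate P? {suc n} f with does (P? (f zero))
... | true  = cong suc (count-tabulate P? (f ∘ suc))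
... | false = count-tabulate P? (f ∘ suc)

-- Counting the vertices within distance `a`

-- With positions counted from 0, this is when an odd-indexed entry `a` gives an arc from `x` to
-- `y`; an even-indexed one gives the reverse arc under the same condition.
Near : ℕ → ℕ → ℕ → Set
Near a x y = x < y × y ≤ x + a

near? : ∀ a x y → Dec (Near a x y)
near? a x y = x <? y ×-dec y ≤? x + a

near-suc : ∀ a x y → ⟦ near? a (suc x) (suc y) ⟧ ≡ ⟦ near? a x y ⟧
near-suc a x y = ⟦⟧-cong (near? a (suc x) (suc y)) (near? a x y)
  (mk⇔ (λ (p , q) → s<s⁻¹ p , s≤s⁻¹ q) (λ (p , q) → s<s p , s≤s q))

-- Raising `m` by one raises the minimum exactly when `m` is still below `a`, which is what the
-- bracket records.
⊓-suc : ∀ a m → ⟦ near? a 0 (suc m) ⟧ + a ⊓ m ≡ a ⊓ suc m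
⊓-suc a m with suc m ≤? a
... | yes m<a = trans (cong₂ _+_ (⟦⟧-cong (near? a 0 (suc m)) (yes m<a) (mk⇔ (λ _ → m<a) (λ _ → z<s , m<a)))
                        (m≥n⇒m⊓n≡n (<⇒≤ m<a)))
                (sym (m≥n⇒m⊓n≡n m<a))
... | no  m≮a = trans (cong₂ _+_ (⟦⟧-false (near? a 0 (suc m)) (λ (_ , m<a) → m≮a m<a))
                        (m≤n⇒m⊓n≡m (≮⇒≥ m≮a)))
                (sym (m≤n⇒m⊓n≡m (m≤n⇒m≤1+n (≮⇒≥ m≮a))))

∑-initial : ∀ a m → ∑[ j < m ] ⟦ near? a 0 (suc (toℕ j)) ⟧ ≡ a ⊓ m
∑-initial zero    m       = trans (sum-cong-≗ {m} (λ j → ⟦⟧-false (near? 0 0 (suc (toℕ j))) λ ()))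
                              (∑.sum-replicate-zero m)
∑-initial (suc a) zero    = refl
∑-initial (suc a) (suc m) = cong suc (trans (sum-cong-≗ {m} shift) (∑-initial a m))
  where
  shift : ∀ j → ⟦ near? (suc a) 0 (suc (suc (toℕ j))) ⟧ ≡ ⟦ near? a 0 (suc (toℕ j)) ⟧
  shift j = ⟦⟧-cong (near? (suc a) 0 (suc (suc (toℕ j)))) (near? a 0 (suc (toℕ j)))
    (mk⇔ (λ (_ , q) → z<s , s≤s⁻¹ q) (λ (_ , q) → z<s , s≤s q))

∑-after : ∀ a {n} (i : Fin n) → ∑[ j < n ] ⟦ near? a (toℕ i) (toℕ j) ⟧ ≡ a ⊓ (n ∸ index i)
∑-after a {suc m} zero    = ∑-initial a m
∑-after a {suc m} (suc i) = trans (sum-cong-≗ {m} (λ j → near-suc a (toℕ i) (toℕ j))) (∑-after a i)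

-- Induction by removing the first vertex and shifting the rest; the bracket of the removed vertex
-- is absorbed by `⊓-suc`.
∑-before : ∀ a {n} (i : Fin n) → ∑[ j < n ] ⟦ near? a (toℕ j) (toℕ i) ⟧ ≡ a ⊓ toℕ i
∑-before a {suc m} zero    = trans (∑.sum-replicate-zero m) (sym (⊓-zeroʳ a))
∑-before a {suc m} (suc i) = trans
  (cong (⟦ near? a 0 (suc (toℕ i)) ⟧ +_)
    (trans (sum-cong-≗ {m} (λ j → near-suc a (toℕ j) (toℕ i))) (∑-before a i)))
  (⊓-suc a (toℕ i))

-- The degree as a sum over string entries

entryDegree : ∀ {n} → ℕ → Fin n → ℕ
entryDegree {n} a i = a ⊓ toℕ i + a ⊓ (n ∸ index i)

module _ {l : ℕ} (s : Vec ℕ l) where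

  module _ {n : ℕ} (i : Fin n) (t : Fin l) where

    private
      a = lookup s t

    -- The parity of the index only decides which of the two sums counts the vertices before `i` and
    -- which those after it; the total is the same.
    ∑-contributes : ∑[ j < n ] ⟦ contributes? s i j t ⟧ + ∑[ j < n ] ⟦ contributes? s j i t ⟧
                    ≡ entryDegree a i
    ∑-contributes with 2 ∣? index t
    ... | no odd = trans (cong₂ _+_
              (trans (sum-cong-≗ {n} (λ j → arc i j)) (∑-after a i))
              (trans (sum-cong-≗ {n} (λ j → arc j i)) (∑-before a i)))
            (+-comm (a ⊓ (n ∸ index i)) _)
      where
      arc : ∀ (i j : Fin n) → ⟦ contributes? s i j t ⟧ ≡ ⟦ near? a (toℕ i) (toℕ j) ⟧
      arc i j = ⟦⟧-cong (contributes? s i j t) (near? a (toℕ i) (toℕ j)) (mk⇔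
        (λ { (inj₁ (_ , p , q)) → s<s⁻¹ p , s≤s⁻¹ q
           ; (inj₂ (even , _)) → contradiction even odd })
        (λ (p , q) → inj₁ (odd , s<s p , s≤s q)))
    ... | yes even = cong₂ _+_
              (trans (sum-cong-≗ {n} (λ j → arc i j)) (∑-before a i))
              (trans (sum-cong-≗ {n} (λ j → arc j i)) (∑-after a i))
      where
      arc : ∀ (i j : Fin n) → ⟦ contributes? s i j t ⟧ ≡ ⟦ near? a (toℕ j) (toℕ i) ⟧
      arc i j = ⟦⟧-cong (contributes? s i j t) (near? a (toℕ j) (toℕ i)) (mk⇔
        (λ { (inj₁ (odd , _)) → contradiction even odd
           -- Truncation does no harm: `x ∸ a ≤ y` is equivalent to `x ≤ a + y` even when `a`
           -- exceeds `x`.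
           ; (inj₂ (_ , p , q)) → s<s⁻¹ p , s≤s⁻¹ (≤-trans (m≤n+m∸n (index i) a)
               (≤-trans (+-monoʳ-≤ a q) (≤-reflexive (+-comm a (index j))))) })
        (λ (p , q) → inj₂ (even , s<s p , m≤n+o⇒m∸n≤o (index i) a
               (≤-trans (s≤s q) (≤-reflexive (+-comm (index j) a))))))

  degree-ornated : ∀ {n} (i : Fin n) →
                   degree (ornated n s) i ≡ ∑[ t < l ] entryDegree (lookup s t) i
  degree-ornated {n} i = trans
    (cong₂ _+_ (swap (λ j → contributes? s i j)) (swap (λ j → contributes? s j i)))
    (trans (sym (∑-distrib-+ {l} (λ t → ∑[ j < n ] ⟦ contributes? s i j t ⟧) _))
      (sum-cong-≗ {l} (∑-contributes i)))
    where
    -- Stated for an arbitrary predicate to serve both out-arcs and in-arcs; `tabulate id` is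
    -- `allFin l` unfolded.
    swap : {P : Fin n → Fin l → Set} (P? : ∀ j t → Dec (P j t)) →
           sum (tabulate (λ j → count (P? j) (tabulate id)))
           ≡ ∑[ t < l ] ∑[ j < n ] ⟦ P? j t ⟧
    swap P? = trans (sum-tabulate {n} _)
      (trans (sum-cong-≗ {n} (λ j → count-tabulate (P? j) id))
        (∑-comm {n} {l} (λ j t → ⟦ P? j t ⟧)))

  entries≤sum : ∀ t → lookup s t ≤ sum s
  entries≤sum t = subst (lookup s t ≤_) (sym (sum-lookup s)) (term≤∑ (lookup s) t)

-- Extremal degrees, connectivity and the Kyle order

entryDegree≤ : ∀ a {n} (i : Fin n) → entryDegree a i ≤ a + a
entryDegree≤ a i = +-mono-≤ (m⊓n≤m a _) (m⊓n≤m a _)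

toℕ+∸index : ∀ {n} (i : Fin n) → toℕ i + (n ∸ index i) ≡ n ∸ 1
toℕ+∸index {suc m} i = m+[n∸m]≡n (s≤s⁻¹ (toℕ<n i))

degree≤Δ : ∀ {n} .{{_ : NonZero n}} (G : MultiDigraph n) v → degree G v ≤ Δ G
degree≤Δ G v = All.lookup (Extrema.xs≤max (degree G v₁) _) (∈ₚ.∈-map⁺ (degree G) (∈ₚ.∈-allFin v))

δ-minimiser : ∀ {n} .{{_ : NonZero n}} (G : MultiDigraph n) →
              (∀ v → degree G v₁ ≤ degree G v) → δ G ≡ degree G v₁
δ-minimiser {n} G v₁≤ = ≤-antisym
  (Extrema.min≤⊤ _ (List.map (degree G) (List.allFin n)))
  (Extrema.v≤min⁺ ≤-refl (Allₚ.map⁺ (All.universal v₁≤ (List.allFin n))))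

-- A walk between distinct vertices is non-empty, and its first step is an arc leaving or entering
-- `u`.
connected⇒degree>0 : ∀ {n} (G : MultiDigraph n) → Connected G →
                     ∀ {u v} → u ≢ v → 0 < degree G u
connected⇒degree>0 G conn {u} {v} u≢v with conn u v
... | ε                     = contradiction refl u≢v
... | _◅_ {j = w} (fwd a) _ = m≤n⇒m≤n+o _ (≤-trans a (term≤sum (MultiDigraph.mult G u) w))
... | _◅_ {j = w} (bwd a) _ = m≤n⇒m≤o+n (outDegree G u) (≤-trans a (term≤sum (λ x → MultiDigraph.mult G x u) w))

-- The vertex of maximum possible degree has degree at least twice the sum of the entries, so no
-- entry falls short of its own maximum `a + a` there. Both minima then equal `a`, and the vertices
-- on the two sides number at least `a + a`.
kyle⇒2a≤k∸1 : ∀ {l} (s : Vec ℕ l) {k} → IsKyleOrder s k →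
              ∀ t → lookup s t + lookup s t ≤ k ∸ 1
kyle⇒2a≤k∸1 {l} s {k} kyle t with IsKyleOrder.hasVertex kyle
... | v , degree≡D = begin
  a t + a t                         ≤⟨ ∑-mono-tight (λ t → entryDegree≤ (a t) v) ∑2a≤∑ t ⟩
  a t ⊓ toℕ v + a t ⊓ (k ∸ index v) ≤⟨ +-mono-≤ (m⊓n≤n (a t) _) (m⊓n≤n (a t) _) ⟩
  toℕ v + (k ∸ index v)             ≡⟨ toℕ+∸index v ⟩
  k ∸ 1                             ∎
  where
  open ≤-Reasoning
  open IsKyleOrder kyle hiding (hasVertex)
  A = sum s
  a = lookup s

  -- The middle vertex of a graph of order `A + A + 1` has `A` vertices on each side. As `A` is at
  -- least every entry, both minima in each `entryDegree` equal the entry.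
  centre : Fin (suc (A + A))
  centre = fromℕ A ↑ˡ A

  toℕ-centre : toℕ centre ≡ A
  toℕ-centre = trans (toℕ-↑ˡ (fromℕ A) A) (toℕ-fromℕ A)

  entry : ∀ t → a t + a t ≡ entryDegree (a t) centre
  entry t = sym (cong₂ _+_
    (m≤n⇒m⊓n≡m (≤-trans (entries≤sum s t) (≤-reflexive (sym toℕ-centre))))
    (m≤n⇒m⊓n≡m (≤-trans (entries≤sum s t) (≤-reflexive (sym
      (trans (cong (A + A ∸_) toℕ-centre) (m+n∸m≡n A A)))))))

  ∑2a≤∑ : ∑[ t < l ] (a t + a t) ≤ ∑[ t < l ] entryDegree (a t) v
  ∑2a≤∑ = begin
    ∑[ t < l ] (a t + a t)                ≡⟨ sum-cong-≗ {l} entry ⟩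
    ∑[ t < l ] entryDegree (a t) centre   ≡⟨ degree-ornated s centre ⟨
    degree (ornated (suc (A + A)) s) centre ≤⟨ degree≤Δ (ornated (suc (A + A)) s) centre ⟩
    Δ (ornated (suc (A + A)) s)             ≤⟨ IsMaxPossibleDegree.bound isMaxPossibleDegree (A + A) ⟩
    maxDegree                             ≡⟨ degree≡D ⟨
    degree (ornated k s) v                ≡⟨ degree-ornated s v ⟩
    ∑[ t < l ] entryDegree (a t) v        ∎

-- Minimum degree and the end vertices

a≤a⊓p+a⊓q : ∀ a p q → a ≤ p + q → a ≤ a ⊓ p + a ⊓ q
a≤a⊓p+a⊓q a p q a≤p+q with ≤-total a p | ≤-total a q
... | inj₁ a≤p | _        rewrite m≤n⇒m⊓n≡m a≤p = m≤m+n a _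
... | inj₂ _   | inj₁ a≤q rewrite m≤n⇒m⊓n≡m a≤q = m≤n+m a _
... | inj₂ p≤a | inj₂ q≤a rewrite m≥n⇒m⊓n≡n p≤a | m≥n⇒m⊓n≡n q≤a = a≤p+q

-- If `a` were positive, one minimum would equal `a`, since `p ≤ a` forces `a ≤ q`; the other
-- minimum is positive, so the sum would exceed `a`.
a⊓p+a⊓q≤a⇒a≡0 : ∀ a p q → 0 < p → 0 < q → a + a ≤ p + q → a ⊓ p + a ⊓ q ≤ a → a ≡ 0
a⊓p+a⊓q≤a⇒a≡0 zero    _ _ _ _ _ _ = refl
a⊓p+a⊓q≤a⇒a≡0 (suc a) (suc p) (suc q) _ _ 2a≤p+q ≤a with ≤-total (suc a) (suc p)
... | inj₁ a≤p = contradiction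
  (subst (_≤ suc a) (trans (cong (_+ suc (a ⊓ q)) (m≤n⇒m⊓n≡m a≤p)) (+-suc (suc a) _)) ≤a)
  (<⇒≱ (s≤s (m≤m+n (suc a) _)))
... | inj₂ p≤a = contradiction
  (subst (_≤ suc a) (cong (suc (a ⊓ p) +_) (m≤n⇒m⊓n≡m a≤q)) ≤a)
  (<⇒≱ (s≤s (m≤n+m (suc a) (a ⊓ p))))
  where
  a≤q : suc a ≤ suc q
  a≤q = +-cancelˡ-≤ (suc a) _ _ (≤-trans 2a≤p+q (+-monoˡ-≤ (suc q) p≤a))

-- Being interior is expressed by the numbers of vertices before and after `v`, the two quantities
-- in `entryDegree`.
end-or-interior : ∀ {m} (v : Fin (suc m)) →
                  (v ≡ v₁ ⊎ v ≡ vₙ) ⊎ (0 < toℕ v × 0 < m ∸ toℕ v)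
end-or-interior     zero      = inj₁ (inj₁ refl)
end-or-interior {m} v@(suc _) with toℕ v <? m
... | yes v<m = inj₂ (z<s , m<n⇒0<n∸m v<m)
... | no  v≮m = inj₁ (inj₂ (toℕ-injective
  (trans (≤-antisym (s≤s⁻¹ (toℕ<n v)) (≮⇒≥ v≮m)) (sym (toℕ-fromℕ m)))))

lemma2p12 : ∀ (l : ℕ) .{{_ : NonZero l}} (s : Vec ℕ l)
    (n : ℕ) .{{_ : NonZero n}} (k : ℕ) → IsKyleOrder s k → k ≤ n →
    Connected (ornated n s) →
    degree (ornated n s) v₁ ≡ degree (ornated n s) vₙ
    × degree (ornated n s) vₙ ≡ δ (ornated n s)
    × δ (ornated n s) ≡ sum s
    × (∀ v → degree (ornated n s) v ≡ δ (ornated n s) → v ≡ v₁ ⊎ v ≡ vₙ)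
lemma2p12 l s (suc m) k kyle k≤n conn =
  trans degree-v₁ (sym degree-vₙ) , trans degree-vₙ (sym δ≡sum) , δ≡sum , unique
  where
  G = ornated (suc m) s
  a = lookup s

  2a≤m : ∀ t → a t + a t ≤ m
  2a≤m t = ≤-trans (kyle⇒2a≤k∸1 s kyle t) (∸-monoˡ-≤ 1 k≤n)

  a≤m : ∀ t → a t ≤ m
  a≤m t = ≤-trans (m≤m+n (a t) _) (2a≤m t)

  degree-if : ∀ v → (∀ t → entryDegree (a t) v ≡ a t) → degree G v ≡ sum s
  degree-if v eq = trans (degree-ornated s v) (trans (sum-cong-≗ {l} eq) (sym (sum-lookup s)))

  degree-v₁ : degree G v₁ ≡ sum s
  -- No vertex precedes `v₁` and `m` follow it, so an entry `a t ≤ m` contributes exactly `a t`;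
  -- `vₙ` is the mirror image.
  degree-v₁ = degree-if zero (λ t → cong₂ _+_ (⊓-zeroʳ (a t)) (m≤n⇒m⊓n≡m (a≤m t)))

  degree-vₙ : degree G vₙ ≡ sum s
  degree-vₙ = degree-if (fromℕ m) λ t → trans
    (cong₂ _+_
      (trans (cong (a t ⊓_) (toℕ-fromℕ m)) (m≤n⇒m⊓n≡m (a≤m t)))
      (trans (cong (a t ⊓_) (trans (cong (m ∸_) (toℕ-fromℕ m)) (n∸n≡0 m))) (⊓-zeroʳ (a t))))
    (+-identityʳ (a t))

  entry≥ : ∀ v t → a t ≤ entryDegree (a t) v
  entry≥ v t = a≤a⊓p+a⊓q (a t) _ _ (subst (a t ≤_) (sym (toℕ+∸index v)) (a≤m t))

  sum≤degree : ∀ v → sum s ≤ degree G v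
  sum≤degree v = subst₂ _≤_ (sym (sum-lookup s)) (sym (degree-ornated s v)) (∑-mono-≤ (entry≥ v))

  δ≡sum : δ G ≡ sum s
  δ≡sum = trans (δ-minimiser G (λ v → subst (_≤ degree G v) (sym degree-v₁) (sum≤degree v))) degree-v₁

  -- Minimum degree forces equality in `entry≥` for every entry, which at an interior vertex makes
  -- every entry zero.
  interior : ∀ v → degree G v ≡ δ G → 0 < toℕ v → 0 < m ∸ toℕ v → sum s ≡ 0
  interior v eq p>0 q>0 = trans (sum-lookup s) (trans (sum-cong-≗ {l} a≡0) (∑.sum-replicate-zero l))
    where
    tight : ∀ t → entryDegree (a t) v ≤ a t
    tight = ∑-mono-tight (entry≥ v) (≤-reflexive
      (trans (sym (degree-ornated s v)) (trans eq (trans δ≡sum (sum-lookup s)))))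

    a≡0 : ∀ t → a t ≡ 0
    a≡0 t = a⊓p+a⊓q≤a⇒a≡0 (a t) _ _ p>0 q>0
      (subst (a t + a t ≤_) (sym (toℕ+∸index v)) (2a≤m t)) (tight t)

  unique : ∀ v → degree G v ≡ δ G → v ≡ v₁ ⊎ v ≡ vₙ
  -- An interior vertex of minimum degree would have degree 0, but it differs from `v₁`, so
  -- connectivity gives it an arc.
  unique v eq = [ id , (λ (p>0 , q>0) → contradiction
    (trans eq (trans δ≡sum (interior v eq p>0 q>0)))
    (>⇒≢ (connected⇒degree>0 G conn {v} {v₁} (λ v≡v₁ → >⇒≢ p>0 (cong toℕ v≡v₁))))) ]′
    (end-or-interior v)
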